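{- Let $D=(E,\mathcal{F})$ be a delta-matroid and let $<$ be any total order on $E$. For $F\in\mathcal{F}$, let $i(F)$ be the number of points of $E$ that are internal, active, and orientable with respect to $F$, and let $j(F)$ be the number of points of $E$ that are external, active, and orientable with respect to $F$. Then $$Q_{(w,x,0)}(D;y)=\sum_{F\in\mathcal{F}} w^{|E|-|F|}\,x^{|F|}\,\bigl(1+(w/x)y\bigr)^{i(F)}\bigl(1+(x/w)y\bigr)^{j(F)} .$$
   Context: A delta-matroid is a pair $D=(E,\mathcal{F})$ where $E$ is a finite set and $\mathcal{F}$ is a nonempty collection of subsets of $E$ (the feasible sets) such that for all $X,Y\in\mathcal{F}$ and $a\in X\Delta Y$ there exists $b\in X\Delta Y$, not necessarily distinct from $a$, with $X\Delta\{a,b\}\in\mathcal{F}$ ($\Delta$ is symmetric difference). For $X\subseteq E$ the twist is $D*X=(E,\{X\Delta F: F\in\mathcal{F}\})$, which is again a delta-matroid. Transition polynomial: let $r_{\min}(D)$ denote the minimum cardinality of a feasible set of $D$. Let $P_3$ be the set of ordered triples $(A,B,C)$ of pairwise disjoint (possibly empty) subsets of $E$ with union $E$. Define $Q_{(w,x,z)}(D;y)=\sum_{(A,B,C)\in P_3} w^{|A|}x^{|B|}z^{|C|}y^{r_{\min}(D*B)}$, with $w,x,y,z$ indeterminates. With $z=0$ (and $0^0=1$) this is $Q_{(w,x,0)}(D;y)=\sum_{B\subseteq E} w^{|E\setminus B|}x^{|B|}y^{r_{\min}(D*B)}$. Activities: fix $F\in\mathcal{F}$. A point $a\in E$ is $F$-nonorientable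 if $\{a\}$ is feasible in $D*F$, and $F$-orientable (orientable with respect to $F$) otherwise. A pair $\{a,b\}\subseteq E$, $a\neq b$, is $F$-paired if $\{a,b\}$ is feasible in $D*F$, and $F$-separated otherwise. Distinct points $a,b$ are $F$-interlaced if either (1) at most one of $a,b$ is $F$-nonorientable and $\{a,b\}$ is $F$-paired, or (2) both $a$ and $b$ are $F$-nonorientable and $\{a,b\}$ is $F$-separated. Given a total order $<$ on $E$, a point $a$ is active with respect to $F$ if $a$ is not $F$-interlaced with any lower-ordered point. A point $a$ is internal (with respect to $F$) if $a\in F$ and external otherwise. -}

module Defs where

open import Algebra.Bundles using (CommutativeRing)
open import Data.Bool using (_xor_)
import Data.Bool.Properties as Bool
open import Data.Fin using (Fin)
open import Data.Fin.Properties using (all?) renaming (_≟_ to _≟ᶠ_)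
open import Data.Fin.Subset using
  (Subset; inside; outside; _∈_; _∉_; _∩_; _∪_; ⁅_⁆; ∣_∣; ⊤; ⊥)
open import Data.Fin.Subset.Properties using (_∈?_)
open import Data.List using
  (List; []; _∷_; _++_; map; filter; foldr; length; allFin; cartesianProduct)
open import Data.List.Extrema.Nat using (min)
open import Data.Nat using (ℕ; zero; suc)
open import Data.Product using (∃; _×_; _,_)
open import Data.Sum using (_⊎_)
open import Data.Vec using ([]; _∷_; zipWith)
open import Data.Vec.Properties using
  (≡-dec; zipWith-assoc; zipWith-comm; zipWith-identityˡ)
open import Function using (_∘_)
open import Relation.Binary using
  (Rel; DecidableEquality; IsStrictTotalOrder)
  renaming (Decidable to Decidable₂)
open import Relation.Binary.PropositionalEquality
open import Relation.Nullary using (¬_; Dec)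
open import Relation.Nullary.Decidable using (map′; ¬?; _×-dec_; _⊎-dec_; _→-dec_)
open import Relation.Unary using (Pred; Decidable)
import Algebra.Properties.Semiring.Exp as Exp
open import Level using (0ℓ)

private
  variable
    n : ℕ

infix 4 _≟ˢ_

_≟ˢ_ : DecidableEquality (Subset n)
_≟ˢ_ = ≡-dec Bool._≟_

subsets : ∀ n → List (Subset n)
subsets zero    = [] ∷ []
subsets (suc n) = map (outside ∷_) (subsets n) ++ map (inside ∷_) (subsets n)

infixr 6 _Δ_

_Δ_ : Subset n → Subset n → Subset n
_Δ_ = zipWith _xor_

Δ-assoc : (X Y Z : Subset n) → (X Δ Y) Δ Z ≡ X Δ (Y Δ Z)
Δ-assoc = zipWith-assoc Bool.xor-assoc

Δ-comm : (X Y : Subset n) → X Δ Y ≡ Y Δ X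
Δ-comm = zipWith-comm Bool.xor-comm

Δ-identityˡ : (X : Subset n) → ⊥ Δ X ≡ X
Δ-identityˡ = zipWith-identityˡ Bool.xor-identityˡ

Δ-self : (X : Subset n) → X Δ X ≡ ⊥
Δ-self []      = refl
Δ-self (b ∷ X) = cong₂ _∷_ (Bool.xor-same b) (Δ-self X)

Δ-cancelˡ : (X Y : Subset n) → X Δ (X Δ Y) ≡ Y
Δ-cancelˡ X Y = begin
  X Δ (X Δ Y)  ≡⟨ Δ-assoc X X Y ⟨
  (X Δ X) Δ Y  ≡⟨ cong (_Δ Y) (Δ-self X) ⟩
  ⊥ Δ Y        ≡⟨ Δ-identityˡ Y ⟩
  Y            ∎
  where open ≡-Reasoning

Δ-translate : (X F G : Subset n) → (X Δ F) Δ (X Δ G) ≡ F Δ G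
Δ-translate X F G = begin
  (X Δ F) Δ (X Δ G)  ≡⟨ cong (_Δ (X Δ G)) (Δ-comm X F) ⟩
  (F Δ X) Δ (X Δ G)  ≡⟨ Δ-assoc F X (X Δ G) ⟩
  F Δ (X Δ (X Δ G))  ≡⟨ cong (F Δ_) (Δ-cancelˡ X G) ⟩
  F Δ G              ∎
  where open ≡-Reasoning

-- The ground set E is Fin n.  The collection of feasible sets is a decidable
-- predicate, so that sums and minima over it can be computed.
record DeltaMatroid (n : ℕ) : Set₁ where
  field
    Feasible  : Pred (Subset n) 0ℓ
    feasible? : Decidable Feasible
    nonempty  : ∃ Feasible
    exchange  : ∀ {X Y} → Feasible X → Feasible Y →
                ∀ {a} → a ∈ X Δ Y →
                ∃ λ b → b ∈ X Δ Y × Feasible (X Δ (⁅ a ⁆ ∪ ⁅ b ⁆))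

  feasibleSets : List (Subset n)
  feasibleSets = filter feasible? (subsets n)

  -- The default value n of the minimum is harmless: no subset is larger, and
  -- feasibleSets is never empty.
  rMin : ℕ
  rMin = min n (map ∣_∣ feasibleSets)

open DeltaMatroid

infixl 7 _*ᵗ_

_*ᵗ_ : DeltaMatroid n → Subset n → DeltaMatroid n
D *ᵗ X = record
  { Feasible  = λ Y → ∃ λ F → Feasible D F × Y ≡ X Δ F
  ; feasible? = λ Y → map′
      (λ h → X Δ Y , h , sym (Δ-cancelˡ X Y))
      (λ { (F , h , refl) → subst (Feasible D) (sym (Δ-cancelˡ X F)) h })
      (feasible? D (X Δ Y))
  ; nonempty  = let F , h = nonempty D in X Δ F , F , h , refl
  ; exchange  = λ { (F , hF , refl) (G , hG , refl) {a} a∈ →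
      let b , b∈ , h = exchange D hF hG (subst (a ∈_) (Δ-translate X F G) a∈)
      in b , subst (b ∈_) (sym (Δ-translate X F G)) b∈
           , F Δ (⁅ a ⁆ ∪ ⁅ b ⁆) , h , Δ-assoc X F _ }
  }

module Activity (D : DeltaMatroid n) (F : Subset n) where

  Nonorientable : Pred (Fin n) 0ℓ
  Nonorientable a = Feasible (D *ᵗ F) ⁅ a ⁆

  Orientable : Pred (Fin n) 0ℓ
  Orientable a = ¬ Nonorientable a

  Paired : Rel (Fin n) 0ℓ
  Paired a b = Feasible (D *ᵗ F) (⁅ a ⁆ ∪ ⁅ b ⁆)

  Separated : Rel (Fin n) 0ℓ
  Separated a b = ¬ Paired a b

  Interlaced : Rel (Fin n) 0ℓ
  Interlaced a b = a ≢ b ×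
    ( (¬ (Nonorientable a × Nonorientable b) × Paired a b)
    ⊎ ((Nonorientable a × Nonorientable b) × Separated a b) )

  Internal : Pred (Fin n) 0ℓ
  Internal a = a ∈ F

  External : Pred (Fin n) 0ℓ
  External a = a ∉ F

  nonorientable? : Decidable Nonorientable
  nonorientable? a = feasible? (D *ᵗ F) ⁅ a ⁆

  paired? : Decidable₂ Paired
  paired? a b = feasible? (D *ᵗ F) (⁅ a ⁆ ∪ ⁅ b ⁆)

  interlaced? : Decidable₂ Interlaced
  interlaced? a b = ¬? (a ≟ᶠ b) ×-dec
    (     (¬? both? ×-dec paired? a b)
    ⊎-dec (both? ×-dec ¬? (paired? a b)) )
    where
    both? : Dec (Nonorientable a × Nonorientable b)
    both? = nonorientable? a ×-dec nonorientable? b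

  module _ {r} {_<_ : Rel (Fin n) r} (sto : IsStrictTotalOrder _≡_ _<_) where

    Active : Pred (Fin n) r
    Active a = ∀ b → b < a → ¬ Interlaced a b

    active? : Decidable Active
    active? a = all? λ b →
      IsStrictTotalOrder._<?_ sto b a →-dec ¬? (interlaced? a b)

    internalActivity : ℕ
    internalActivity = length (filter
      (λ a → (a ∈? F) ×-dec (active? a ×-dec ¬? (nonorientable? a)))
      (allFin n))

    externalActivity : ℕ
    externalActivity = length (filter
      (λ a → ¬? (a ∈? F) ×-dec (active? a ×-dec ¬? (nonorientable? a)))
      (allFin n))

open Activity public using (internalActivity; externalActivity)

Partition₃ : Pred (Subset n × Subset n × Subset n) 0ℓ
Partition₃ (A , B , C) =
  (A ∩ B ≡ ⊥ × A ∩ C ≡ ⊥ × B ∩ C ≡ ⊥) × A ∪ B ∪ C ≡ ⊤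

partition₃? : Decidable (Partition₃ {n})
partition₃? (A , B , C) =
  ((A ∩ B ≟ˢ ⊥) ×-dec ((A ∩ C ≟ˢ ⊥) ×-dec (B ∩ C ≟ˢ ⊥)))
  ×-dec (A ∪ B ∪ C ≟ˢ ⊤)

P₃ : ∀ n → List (Subset n × Subset n × Subset n)
P₃ n = filter partition₃?
  (cartesianProduct (subsets n) (cartesianProduct (subsets n) (subsets n)))

-- The indeterminates w, x, z, y are represented by arbitrary elements of an
-- arbitrary commutative ring; _^_ satisfies 0# ^ 0 = 1#.
module OverRing {c ℓ} (R : CommutativeRing c ℓ) where

  open CommutativeRing R
  open Exp semiring public using (_^_)

  ∑ : ∀ {a} {A : Set a} → List A → (A → Carrier) → Carrier
  ∑ xs f = foldr _+_ 0# (map f xs)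

  Q : (w x z : Carrier) → DeltaMatroid n → (y : Carrier) → Carrier
  Q {n} w x z D y = ∑ (P₃ n) λ (A , B , C) →
    w ^ ∣ A ∣ * x ^ ∣ B ∣ * z ^ ∣ C ∣ * y ^ rMin (D *ᵗ B)

{-# OPTIONS --safe #-}

-- Expanding the powers of 1 + (w/x) y and 1 + (x/w) y turns the right-hand side
-- into a sum of w^|E∖B| x^|B| y^|B Δ F| over the pairs (F , B) for which every
-- point of B Δ F is active and orientable with respect to F.  So it suffices
-- that each B occurs with exactly one feasible F, and that this F satisfies
-- |B Δ F| = rMin (D * B).
--
-- Uniqueness: if F ≠ G both occur with B, let m be the largest point of F Δ G;
-- it lies in B Δ F or in B Δ G, say in B Δ F.  Exchanging F towards G at m gives
-- b ≤ m with F Δ {m,b} feasible, so m is nonorientable (b = m) or interlaced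
-- with the smaller b.
--
-- Existence: among the feasible F with |B Δ F| minimal take one for which the
-- sum of the ranks of the points of B Δ F is minimal.  A nonorientable or
-- inactive point of B Δ F would allow a step decreasing |B Δ F| or replacing a
-- point of B Δ F by a smaller one.
module Submission where

open import Defs
open import Algebra.Bundles using (CommutativeRing)
open import Data.Bool using (true; false; not; if_then_else_)
open import Data.Fin using (Fin; zero; suc)
open import Data.Fin.Induction using (spo-noetherian)
open import Data.Fin.Subset using
  (Subset; inside; outside; _∈_; _∉_; _⊆_; _∩_; _∪_; ∁; ⁅_⁆; ∣_∣; ⊥)
open import Data.Fin.Subset.Properties
open import Data.List using (List; []; _∷_; _++_; map; filter; length; cartesianProduct)
import Data.List as List
import Data.List.Properties as List
open import Data.List.Extrema.Nat using
  (argmin; f[argmin]≤f[xs]; argmin-all; min≤v⁺; v≤min⁺)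
import Data.List.Membership.Propositional as List
import Data.List.Membership.Propositional.Properties as List
import Data.List.Relation.Unary.All as All
open import Data.List.Relation.Unary.All.Properties using (all-filter)
import Data.List.Relation.Unary.Any as Any
open import Data.Nat as ℕ using (ℕ; zero; suc; _∸_; _≤_)
import Data.Nat.Properties as ℕ
open import Data.Product using (∃; _×_; _,_; proj₁; proj₂)
open import Data.Sum using (_⊎_; inj₁; inj₂; [_,_]′)
open import Data.Vec using ([]; _∷_; here; there; tabulate)
open import Data.Vec.Properties using ([]=⇒lookup; lookup⇒[]=; lookup∘tabulate; tabulate-∘)
open import Function using (_∘_; const; flip)
open import Induction.WellFounded using (Acc; acc)
open import Relation.Binary using (Rel; IsStrictTotalOrder; tri<; tri≈; tri>)
open import Relation.Binary.PropositionalEquality hiding (setoid)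
open import Relation.Nullary using (¬_; Dec; yes; no; does; contradiction)
open import Relation.Nullary.Decidable using (dec-true; ¬?; _×-dec_)
open import Relation.Unary using (Pred; Decidable)
open import Algebra.Properties.CommutativeSemigroup ℕ.+-commutativeSemigroup using (x∙yz≈y∙xz)

private
  variable
    n : ℕ

-- Subsets: enumeration, minimisers, symmetric difference, comprehension.

∈-subsets : (X : Subset n) → X List.∈ subsets n
∈-subsets []            = Any.here refl
∈-subsets (outside ∷ X) = List.∈-++⁺ˡ (List.∈-map⁺ (outside ∷_) (∈-subsets X))
∈-subsets {suc n} (inside ∷ X) =
  List.∈-++⁺ʳ (map (outside ∷_) (subsets n)) (List.∈-map⁺ (inside ∷_) (∈-subsets X))

minimiser : ∀ {p} {P : Pred (Subset n) p} → Decidable P → ∃ P → (f : Subset n → ℕ) →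
            ∃ λ X → P X × (∀ Y → P Y → f X ≤ f Y)
minimiser P? (X , pX) f =
  -- The given `X` is the default of `argmin`; as it satisfies `P` itself, the result satisfies `P`
  -- in every case.
  argmin f X candidates ,
  argmin-all f pX (all-filter P? (subsets _)) ,
  λ Y pY → All.lookup (f[argmin]≤f[xs] X candidates) (List.∈-filter⁺ P? (∈-subsets Y) pY)
  where candidates = filter P? (subsets _)

∈Δ⁻ : ∀ {a} (X Y : Subset n) → a ∈ X Δ Y → a ∈ X ⊎ a ∈ Y
∈Δ⁻ (inside  ∷ X) (outside ∷ Y) here = inj₁ here
∈Δ⁻ (outside ∷ X) (inside  ∷ Y) here = inj₂ here
∈Δ⁻ (_ ∷ X) (_ ∷ Y) (there a∈) = [ inj₁ ∘ there , inj₂ ∘ there ]′ (∈Δ⁻ X Y a∈)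

Δ-identityʳ : (X : Subset n) → X Δ ⊥ ≡ X
Δ-identityʳ X = trans (Δ-comm X ⊥) (Δ-identityˡ X)

Δ-⊥⇒≡ : (X Y : Subset n) → X Δ Y ≡ ⊥ → X ≡ Y
Δ-⊥⇒≡ X Y eq = begin
  X            ≡⟨ Δ-identityʳ X ⟨
  X Δ ⊥        ≡⟨ cong (X Δ_) eq ⟨
  X Δ (X Δ Y)  ≡⟨ Δ-cancelˡ X Y ⟩
  Y            ∎
  where open ≡-Reasoning

pair-Δ : {a b : Fin n} → a ≢ b → ⁅ a ⁆ ∪ ⁅ b ⁆ ≡ ⁅ a ⁆ Δ ⁅ b ⁆
pair-Δ {a = zero}  {zero}  a≢b = contradiction refl a≢b
pair-Δ {a = zero}  {suc b} a≢b =
  cong (inside ∷_) (trans (∪-identityˡ ⁅ b ⁆) (sym (Δ-identityˡ ⁅ b ⁆)))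
pair-Δ {a = suc a} {zero}  a≢b =
  cong (inside ∷_) (trans (∪-identityʳ ⁅ a ⁆) (sym (Δ-identityʳ ⁅ a ⁆)))
pair-Δ {a = suc a} {suc b} a≢b = cong (outside ∷_) (pair-Δ (a≢b ∘ cong suc))

comprehension : ∀ {p} {P : Pred (Fin n) p} → Decidable P → Subset n
comprehension P? = tabulate (does ∘ P?)

module _ {p} {P : Pred (Fin n) p} (P? : Decidable P) where

  ∈-comprehension⁺ : ∀ {a} → P a → a ∈ comprehension P?
  ∈-comprehension⁺ {a} pa =
    lookup⇒[]= a _ (trans (lookup∘tabulate (does ∘ P?) a) (dec-true (P? a) pa))

  ∈-comprehension⁻ : ∀ {a} → a ∈ comprehension P? → P a
  ∈-comprehension⁻ {a} a∈ with P? a | trans (sym (lookup∘tabulate (does ∘ P?) a)) ([]=⇒lookup a∈)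
  ... | yes pa | _ = pa
  ... | no  _  | ()

-- General in `f` because the tail of `List.tabulate f` is `List.tabulate (f ∘ suc)`; `allFin` is
-- the case of the identity.
length-filter-tabulate : ∀ {a p} {A : Set a} {P : Pred A p} (P? : Decidable P) (f : Fin n → A) →
  length (filter P? (List.tabulate f)) ≡ ∣ comprehension (P? ∘ f) ∣
length-filter-tabulate {zero}  P? f = refl
length-filter-tabulate {suc n} P? f with does (P? (f zero))
... | true  = cong suc (length-filter-tabulate P? (f ∘ suc))
... | false = length-filter-tabulate P? (f ∘ suc)

-- Weights of subsets under removal, insertion and exchange of points.

weight : (Fin n → ℕ) → Subset n → ℕ
weight v []            = 0
weight v (outside ∷ X) = weight (v ∘ suc) X
weight v (inside  ∷ X) = v zero ℕ.+ weight (v ∘ suc) X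

weight-1 : (X : Subset n) → weight (const 1) X ≡ ∣ X ∣
weight-1 []            = refl
weight-1 (outside ∷ X) = weight-1 X
weight-1 (inside  ∷ X) = cong suc (weight-1 X)

weight-remove : ∀ (v : Fin n → ℕ) {X a} → a ∈ X → weight v X ≡ v a ℕ.+ weight v (X Δ ⁅ a ⁆)
weight-remove v {inside ∷ X} here = cong (λ Y → v zero ℕ.+ weight (v ∘ suc) Y) (sym (Δ-identityʳ X))
weight-remove v {outside ∷ X} (there a∈) = weight-remove (v ∘ suc) a∈
weight-remove v {inside ∷ X} {suc a} (there a∈) = begin
  v zero ℕ.+ weight (v ∘ suc) X                           ≡⟨ cong (v zero ℕ.+_) (weight-remove (v ∘ suc) a∈) ⟩
  v zero ℕ.+ (v (suc a) ℕ.+ weight (v ∘ suc) (X Δ ⁅ a ⁆)) ≡⟨ x∙yz≈y∙xz (v zero) (v (suc a)) _ ⟩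
  v (suc a) ℕ.+ (v zero ℕ.+ weight (v ∘ suc) (X Δ ⁅ a ⁆)) ∎
  where open ≡-Reasoning

weight-insert : ∀ (v : Fin n → ℕ) {X a} → a ∉ X → weight v (X Δ ⁅ a ⁆) ≡ v a ℕ.+ weight v X
weight-insert v {outside ∷ X} {zero}  a∉ = cong (λ Y → v zero ℕ.+ weight (v ∘ suc) Y) (Δ-identityʳ X)
weight-insert v {inside  ∷ X} {zero}  a∉ = contradiction here a∉
weight-insert v {outside ∷ X} {suc a} a∉ = weight-insert (v ∘ suc) (a∉ ∘ there)
weight-insert v {inside  ∷ X} {suc a} a∉ = begin
  v zero ℕ.+ weight (v ∘ suc) (X Δ ⁅ a ⁆)         ≡⟨ cong (v zero ℕ.+_) (weight-insert (v ∘ suc) (a∉ ∘ there)) ⟩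
  v zero ℕ.+ (v (suc a) ℕ.+ weight (v ∘ suc) X)   ≡⟨ x∙yz≈y∙xz (v zero) (v (suc a)) _ ⟩
  v (suc a) ℕ.+ (v zero ℕ.+ weight (v ∘ suc) X)   ∎
  where open ≡-Reasoning

-- The term `v a` stands next to the new weight so that nothing is subtracted in `ℕ`. Unit weights
-- show that a swap preserves cardinality; ranks show that the weight drops when the new point is
-- lower.
weight-swap : ∀ (v : Fin n → ℕ) {X a b} → a ∈ X → b ∉ X → a ≢ b →
              v a ℕ.+ weight v (X Δ (⁅ a ⁆ ∪ ⁅ b ⁆)) ≡ v b ℕ.+ weight v X
weight-swap v {X} {a} {b} a∈ b∉ a≢b = begin
  v a ℕ.+ weight v (X Δ (⁅ a ⁆ ∪ ⁅ b ⁆))       ≡⟨ cong (λ Y → v a ℕ.+ weight v (X Δ Y)) (pair-Δ a≢b) ⟩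
  v a ℕ.+ weight v (X Δ (⁅ a ⁆ Δ ⁅ b ⁆))       ≡⟨ cong (λ Y → v a ℕ.+ weight v Y) (Δ-assoc X _ _) ⟨
  v a ℕ.+ weight v ((X Δ ⁅ a ⁆) Δ ⁅ b ⁆)       ≡⟨ cong (v a ℕ.+_) (weight-insert v b∉′) ⟩
  v a ℕ.+ (v b ℕ.+ weight v (X Δ ⁅ a ⁆))       ≡⟨ x∙yz≈y∙xz (v a) (v b) _ ⟩
  v b ℕ.+ (v a ℕ.+ weight v (X Δ ⁅ a ⁆))       ≡⟨ cong (v b ℕ.+_) (weight-remove v a∈) ⟨
  v b ℕ.+ weight v X                           ∎
  where
  open ≡-Reasoning
  b∉′ : b ∉ X Δ ⁅ a ⁆
  b∉′ = [ b∉ , a≢b ∘ sym ∘ x∈⁅y⁆⇒x≡y a ]′ ∘ ∈Δ⁻ X ⁅ a ⁆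

∣Δ⁅⁆∣< : ∀ {X : Subset n} {a} → a ∈ X → ∣ X Δ ⁅ a ⁆ ∣ ℕ.< ∣ X ∣
∣Δ⁅⁆∣< {X = X} {a} a∈ = ℕ.≤-reflexive (begin
  suc ∣ X Δ ⁅ a ⁆ ∣                   ≡⟨ cong suc (weight-1 (X Δ ⁅ a ⁆)) ⟨
  suc (weight (const 1) (X Δ ⁅ a ⁆))  ≡⟨ weight-remove (const 1) a∈ ⟨
  weight (const 1) X                  ≡⟨ weight-1 X ⟩
  ∣ X ∣                               ∎)
  where open ≡-Reasoning

∣Δ-pair∣< : ∀ {X : Subset n} {a b} → a ∈ X → b ∈ X → a ≢ b → ∣ X Δ (⁅ a ⁆ ∪ ⁅ b ⁆) ∣ ℕ.< ∣ X ∣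
∣Δ-pair∣< {X = X} {a} {b} a∈ b∈ a≢b =
  subst (λ Y → ∣ Y ∣ ℕ.< ∣ X ∣) (trans (Δ-assoc X _ _) (cong (X Δ_) (sym (pair-Δ a≢b))))
    (ℕ.<-trans (∣Δ⁅⁆∣< b∈′) (∣Δ⁅⁆∣< a∈))
  where
  b∈′ : b ∈ X Δ ⁅ a ⁆
  -- `X` is rewritten as `⁅ a ⁆ Δ (X Δ ⁅ a ⁆)`; `b` lies in one of the two sets, and `a ≢ b` rules
  -- out the first.
  b∈′ = [ (λ b∈⁅a⁆ → contradiction (sym (x∈⁅y⁆⇒x≡y a b∈⁅a⁆)) a≢b) , (λ z → z) ]′
    (∈Δ⁻ ⁅ a ⁆ (X Δ ⁅ a ⁆) (subst (b ∈_) (sym (trans (cong (⁅ a ⁆ Δ_) (Δ-comm X _)) (Δ-cancelˡ ⁅ a ⁆ X))) b∈))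

∣Δ-pair∣≡ : ∀ {X : Subset n} {a b} → a ∈ X → b ∉ X → a ≢ b → ∣ X Δ (⁅ a ⁆ ∪ ⁅ b ⁆) ∣ ≡ ∣ X ∣
∣Δ-pair∣≡ {X = X} {a} {b} a∈ b∉ a≢b =
  -- With unit weights both sides of `weight-swap` start with a successor, which cancels.
  trans (sym (weight-1 (X Δ (⁅ a ⁆ ∪ ⁅ b ⁆)))) (trans (ℕ.suc-injective (weight-swap (const 1) a∈ b∉ a≢b)) (weight-1 X))

open DeltaMatroid

-- Delta-matroids: the unique feasible set attached to each subset `B`.

rMin-attained : ∀ (D : DeltaMatroid n) {X} → Feasible D X →
                (∀ Y → Feasible D Y → ∣ X ∣ ≤ ∣ Y ∣) → rMin D ≡ ∣ X ∣
rMin-attained {n} D {X} hX least = ℕ.≤-antisym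
  (min≤v⁺ n (map ∣_∣ (feasibleSets D)) (inj₂ (Any.map (ℕ.≤-reflexive ∘ sym)
    (List.∈-map⁺ ∣_∣ (List.∈-filter⁺ (feasible? D) (∈-subsets X) hX)))))
  -- The default value `n` of the minimum has to be bounded below by `∣ X ∣` as well.
  (v≤min⁺ (∣p∣≤n X) (All.tabulate λ s∈ →
    let Y , Y∈ , eq = List.∈-map⁻ ∣_∣ s∈
    in subst (∣ X ∣ ≤_) (sym eq) (least Y (proj₂ (List.∈-filter⁻ (feasible? D) {xs = subsets n} Y∈)))))

module _ (D : DeltaMatroid n) where

  twist⁻ : ∀ {X Y} → Feasible (D *ᵗ X) Y → Feasible D (X Δ Y)
  twist⁻ {X} (F , h , eq) = subst (Feasible D) (sym (trans (cong (X Δ_) eq) (Δ-cancelˡ X F))) h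

  twist⁺ : ∀ {X Y} → Feasible D (X Δ Y) → Feasible (D *ᵗ X) Y
  twist⁺ {X} {Y} h = X Δ Y , h , sym (Δ-cancelˡ X Y)

  module _ {r} {_<_ : Rel (Fin n) r} (sto : IsStrictTotalOrder _≡_ _<_) where
    open IsStrictTotalOrder sto using (_<?_; compare)
      renaming (trans to <-trans; irrefl to <-irrefl)

    ActiveOrientable : Subset n → Pred (Fin n) r
    ActiveOrientable F a = Activity.Active D F sto a × Activity.Orientable D F a

    activeOrientable? : ∀ F → Decidable (ActiveOrientable F)
    activeOrientable? F a = Activity.active? D F sto a ×-dec ¬? (Activity.nonorientable? D F a)

    AO : Subset n → Subset n
    AO F = comprehension (activeOrientable? F)

    -- Turns the order into numbers, so that replacing a point by a lower one is visible as a drop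
    -- of a sum.
    rank : Fin n → ℕ
    rank a = ∣ comprehension (_<? a) ∣

    rank-mono : ∀ {a b} → a < b → rank a ℕ.< rank b
    rank-mono {a} {b} a<b = p⊂q⇒∣p∣<∣q∣
      ( (λ c∈ → ∈-comprehension⁺ (_<? b) (<-trans (∈-comprehension⁻ (_<? a) c∈) a<b))
      , a , ∈-comprehension⁺ (_<? b) a<b
      , λ a∈ → <-irrefl refl (∈-comprehension⁻ (_<? a) a∈) )

    max-Δ-¬activeOrientable : ∀ {F G m} → Feasible D F → Feasible D G → m ∈ F Δ G →
      (∀ b → m < b → b ∉ F Δ G) → ¬ ActiveOrientable F m
    max-Δ-¬activeOrientable {F} {G} {m} hF hG m∈ above (active , orientable)
      with exchange D hF hG m∈
    ... | b , b∈ , h with compare m b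
    ... | tri< m<b _ _ = above b m<b b∈
    -- For `b = m` the union collapses to `⁅ m ⁆`, so `m` is nonorientable.
    ... | tri≈ _ refl _ = orientable (twist⁺ (subst (λ Y → Feasible D (F Δ Y)) (∪-idem ⁅ m ⁆) h))
    -- Since `m` is orientable, the two points are not both nonorientable, and being paired makes
    -- them interlaced.
    ... | tri> _ m≢b b<m = active b b<m (m≢b , inj₁ (orientable ∘ proj₁ , twist⁺ h))

    -- The largest point of `F Δ G` is reached by induction along the converse order: once all
    -- higher points are known to lie outside `F Δ G`, a point `m` inside would be the largest. As
    -- `F Δ G` equals `(B Δ F) Δ (B Δ G)`, such an `m` is active and orientable for one of the two
    -- sets.
    activeOrientable-unique : ∀ {B F G} → Feasible D F → Feasible D G →
      B Δ F ⊆ AO F → B Δ G ⊆ AO G → F ≡ G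
    activeOrientable-unique {B} {F} {G} hF hG F-good G-good =
      Δ-⊥⇒≡ F G (Empty-unique λ (m , m∈) → empty m (noetherian m) m∈)
      where
      noetherian = spo-noetherian (IsStrictTotalOrder.isStrictPartialOrder sto)
      empty : ∀ m → Acc (flip _<_) m → m ∉ F Δ G
      empty m (acc rs) m∈ with ∈Δ⁻ (B Δ F) (B Δ G) (subst (m ∈_) (sym (Δ-translate B F G)) m∈)
      ... | inj₁ m∈F = max-Δ-¬activeOrientable hF hG m∈ (λ b m<b → empty b (rs m<b))
                         (∈-comprehension⁻ (activeOrientable? F) (F-good m∈F))
      ... | inj₂ m∈G = max-Δ-¬activeOrientable hG hF (subst (m ∈_) (Δ-comm F G) m∈)
                         (λ b m<b → empty b (rs m<b) ∘ subst (b ∈_) (Δ-comm G F))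
                         (∈-comprehension⁻ (activeOrientable? G) (G-good m∈G))

    activeOrientable-exists : ∀ B → ∃ λ F →
      Feasible D F × B Δ F ⊆ AO F × rMin (D *ᵗ B) ≡ ∣ B Δ F ∣
    activeOrientable-exists B
      with minimiser (feasible? D) (nonempty D) (λ F → ∣ B Δ F ∣)
    ... | F₀ , h₀ , nearest₀
      -- The rank sum is minimised only among the feasible sets at the least distance from `B`, so
      -- the result is still nearest to `B`.
      with minimiser (λ F → feasible? D F ×-dec (∣ B Δ F ∣ ℕ.≟ ∣ B Δ F₀ ∣)) (F₀ , h₀ , refl)
                     (λ F → weight rank (B Δ F))
    ... | F , (h , ∣F∣≡∣F₀∣) , lightest =
      F , h , (λ a∈ → ∈-comprehension⁺ (activeOrientable? F) (active a∈ , orientable a∈)) ,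
      -- The feasible sets of `D *ᵗ B` are the `B Δ Y` with `Y` feasible in `D`, so the least
      -- distance from `B` is `rMin (D *ᵗ B)`.
      rMin-attained (D *ᵗ B) (F , h , refl) (λ { _ (Y , hY , refl) → nearest Y hY })
      where
      nearest : ∀ Y → Feasible D Y → ∣ B Δ F ∣ ≤ ∣ B Δ Y ∣
      nearest Y hY = subst (_≤ ∣ B Δ Y ∣) (sym ∣F∣≡∣F₀∣) (nearest₀ Y hY)

      nearest-Δ : ∀ {Y} → Feasible D (F Δ Y) → ∣ B Δ F ∣ ≤ ∣ (B Δ F) Δ Y ∣
      nearest-Δ {Y} h = subst (λ Z → ∣ B Δ F ∣ ≤ ∣ Z ∣) (sym (Δ-assoc B F Y)) (nearest _ h)

      orientable : ∀ {a} → a ∈ B Δ F → Activity.Orientable D F a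
      orientable a∈ non = ℕ.<⇒≱ (∣Δ⁅⁆∣< a∈) (nearest-Δ (twist⁻ non))

      active : ∀ {a} → a ∈ B Δ F → Activity.Active D F sto a
      -- The second kind of interlacement would make `a` nonorientable.
      active a∈ b b<a (_ , inj₂ ((non , _) , _)) = orientable a∈ non
      active {a} a∈ b b<a (a≢b , inj₁ (_ , paired)) with b ∈? B Δ F
      ... | yes b∈ = ℕ.<⇒≱ (∣Δ-pair∣< a∈ b∈ a≢b) (nearest-Δ (twist⁻ paired))
      -- Twisting `F` by the pair swaps `a` for the lower `b` in `B Δ F`: the distance from `B`
      -- stays the same and the rank sum drops, against the choice of `F`.
      ... | no  b∉ = ℕ.<-irrefl refl (begin-strict
        rank b ℕ.+ weight rank (B Δ F)         <⟨ ℕ.+-monoˡ-< _ (rank-mono b<a) ⟩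
        rank a ℕ.+ weight rank (B Δ F)         ≤⟨ ℕ.+-monoʳ-≤ (rank a) (lightest _ (twist⁻ paired , ∣F′∣)) ⟩
        rank a ℕ.+ weight rank (B Δ F Δ P)     ≡⟨ cong (λ Z → rank a ℕ.+ weight rank Z) (Δ-assoc B F P) ⟨
        rank a ℕ.+ weight rank ((B Δ F) Δ P)   ≡⟨ weight-swap rank a∈ b∉ a≢b ⟩
        rank b ℕ.+ weight rank (B Δ F)         ∎)
        where
        open ℕ.≤-Reasoning
        P = ⁅ a ⁆ ∪ ⁅ b ⁆
        ∣F′∣ : ∣ B Δ F Δ P ∣ ≡ ∣ B Δ F₀ ∣
        ∣F′∣ = trans (cong ∣_∣ (sym (Δ-assoc B F P))) (trans (∣Δ-pair∣≡ a∈ b∉ a≢b) ∣F∣≡∣F₀∣)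

-- Activities as sizes of intersections.

comprehension-∈? : (X : Subset n) → comprehension (_∈? X) ≡ X
comprehension-∈? []            = refl
comprehension-∈? (outside ∷ X) = cong (outside ∷_) (comprehension-∈? X)
comprehension-∈? (inside  ∷ X) = cong (inside ∷_) (comprehension-∈? X)

comprehension-×-dec : ∀ {p q} {P : Pred (Fin n) p} {Q : Pred (Fin n) q}
  (P? : Decidable P) (Q? : Decidable Q) →
  comprehension (λ a → P? a ×-dec Q? a) ≡ comprehension P? ∩ comprehension Q?
comprehension-×-dec {zero}  P? Q? = refl
comprehension-×-dec {suc n} P? Q? =
  cong (does (P? zero ×-dec Q? zero) ∷_) (comprehension-×-dec (P? ∘ suc) (Q? ∘ suc))

module _ (D : DeltaMatroid n) {r} {_<_ : Rel (Fin n) r} (sto : IsStrictTotalOrder _≡_ _<_)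
         (F : Subset n) where

  private
    AO? = activeOrientable? D sto F

  -- As the size of a set, the exponent can be expanded one coordinate at a time in `∑-twistTerm`.
  internalActivity≡ : internalActivity D F sto ≡ ∣ F ∩ AO D sto F ∣
  internalActivity≡ = begin
    internalActivity D F sto
      ≡⟨ length-filter-tabulate (λ a → (a ∈? F) ×-dec AO? a) (λ a → a) ⟩
    ∣ comprehension (λ a → (a ∈? F) ×-dec AO? a) ∣
      ≡⟨ cong ∣_∣ (comprehension-×-dec (_∈? F) AO?) ⟩
    ∣ comprehension (_∈? F) ∩ AO D sto F ∣
      ≡⟨ cong (λ X → ∣ X ∩ AO D sto F ∣) (comprehension-∈? F) ⟩
    ∣ F ∩ AO D sto F ∣ ∎
    where open ≡-Reasoning

  externalActivity≡ : externalActivity D F sto ≡ ∣ ∁ F ∩ AO D sto F ∣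
  externalActivity≡ = begin
    externalActivity D F sto
      ≡⟨ length-filter-tabulate (λ a → ¬? (a ∈? F) ×-dec AO? a) (λ a → a) ⟩
    ∣ comprehension (λ a → ¬? (a ∈? F) ×-dec AO? a) ∣
      ≡⟨ cong ∣_∣ (comprehension-×-dec (λ a → ¬? (a ∈? F)) AO?) ⟩
    ∣ comprehension (λ a → ¬? (a ∈? F)) ∩ AO D sto F ∣
      -- Negating a decision applies `not` to its `does`, which is how `∁` acts on each entry.
      ≡⟨ cong (λ X → ∣ X ∩ AO D sto F ∣) (tabulate-∘ not (λ a → does (a ∈? F))) ⟩
    ∣ ∁ (comprehension (_∈? F)) ∩ AO D sto F ∣
      ≡⟨ cong (λ X → ∣ ∁ X ∩ AO D sto F ∣) (comprehension-∈? F) ⟩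
    ∣ ∁ F ∩ AO D sto F ∣ ∎
    where open ≡-Reasoning

-- Containment as an empty intersection; tripartitions with empty third part.

⊆⇒∩∁≡⊥ : {X Y : Subset n} → X ⊆ Y → X ∩ ∁ Y ≡ ⊥
⊆⇒∩∁≡⊥ {X = X} {Y} X⊆Y = Empty-unique λ (a , a∈) →
  let a∈X , a∈∁Y = x∈p∩q⁻ X (∁ Y) a∈ in x∈∁p⇒x∉p a∈∁Y (X⊆Y a∈X)

∩∁≡⊥⇒⊆ : {X Y : Subset n} → X ∩ ∁ Y ≡ ⊥ → X ⊆ Y
∩∁≡⊥⇒⊆ {X = X} {Y} eq {a} a∈X with a ∈? Y
... | yes a∈Y = a∈Y
... | no  a∉Y = contradiction (subst (a ∈_) eq (x∈p∩q⁺ (a∈X , x∉p⇒x∈∁p a∉Y))) ∉⊥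

partition₃-∁ : (B : Subset n) → Partition₃ (∁ B , B , ⊥)
partition₃-∁ []            = (refl , refl , refl) , refl
partition₃-∁ (b ∷ B) with partition₃-∁ B
partition₃-∁ (outside ∷ B) | (p , q , r) , s =
  (cong (outside ∷_) p , cong (outside ∷_) q , cong (outside ∷_) r) , cong (inside ∷_) s
partition₃-∁ (inside  ∷ B) | (p , q , r) , s =
  (cong (outside ∷_) p , cong (outside ∷_) q , cong (outside ∷_) r) , cong (inside ∷_) s

partition₃-⊥⇒≡∁ : {A B : Subset n} → Partition₃ (A , B , ⊥) → A ≡ ∁ B
partition₃-⊥⇒≡∁ {A = A} {B} ((A∩B≡⊥ , _) , ∪≡⊤) = ⊆-antisym
  (λ a∈A → x∉p⇒x∈∁p λ a∈B → ∉⊥ (subst (_ ∈_) A∩B≡⊥ (x∈p∩q⁺ (a∈A , a∈B))))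
  (λ a∈∁B → [ (λ a∈A → a∈A)
            , (λ a∈ → contradiction (subst (_ ∈_) (∪-identityʳ B) a∈) (x∈∁p⇒x∉p a∈∁B)) ]′
              (x∈p∪q⁻ A (B ∪ ⊥) (subst (_ ∈_) (sym ∪≡⊤) ∈⊤)))

-- Finite sums over a commutative ring, in particular over all subsets.

module _ {c ℓ} (R : CommutativeRing c ℓ) where
  open CommutativeRing R hiding (zero)
    renaming (refl to ≈-refl; sym to ≈-sym; trans to ≈-trans)
  open OverRing R
  open import Algebra.Properties.Semiring.Exp semiring using (^-congʳ)
  open import Algebra.Properties.CommutativeSemigroup +-commutativeSemigroup using (interchange)
  open import Algebra.Solver.Ring.NaturalCoefficients.Default commutativeSemiring
    using (solve; _:=_; _:+_; _:*_; con)
  open import Relation.Binary.Reasoning.Setoid setoid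

  if-does-true : ∀ {p} {P : Set p} (P? : Dec P) {u : Carrier} →
                 P → (if does P? then u else 0#) ≈ u
  if-does-true (yes _) p = ≈-refl
  if-does-true (no ¬p) p = contradiction p ¬p

  if-does-≈0 : ∀ {p} {P : Set p} (P? : Dec P) {u : Carrier} →
               (P → u ≈ 0#) → (if does P? then u else 0#) ≈ 0#
  if-does-≈0 (yes p) u≈0 = u≈0 p
  if-does-≈0 (no  _) u≈0 = ≈-refl

  module _ {a} {A : Set a} where

    ∑-cong : ∀ (xs : List A) {f g : A → Carrier} → (∀ x → f x ≈ g x) → ∑ xs f ≈ ∑ xs g
    ∑-cong []       f≈g = ≈-refl
    ∑-cong (x ∷ xs) f≈g = +-cong (f≈g x) (∑-cong xs f≈g)

    ∑-++ : ∀ (xs ys : List A) (f : A → Carrier) → ∑ (xs ++ ys) f ≈ ∑ xs f + ∑ ys f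
    ∑-++ []       ys f = ≈-sym (+-identityˡ _)
    ∑-++ (x ∷ xs) ys f = ≈-trans (+-congˡ (∑-++ xs ys f)) (≈-sym (+-assoc _ _ _))

    ∑-map : ∀ {b} {B : Set b} (h : B → A) (xs : List B) (f : A → Carrier) →
            ∑ (map h xs) f ≡ ∑ xs (f ∘ h)
    ∑-map h xs f = cong (List.foldr _+_ 0#) (sym (List.map-∘ xs))

    ∑-0 : ∀ (xs : List A) {f : A → Carrier} → (∀ x → f x ≈ 0#) → ∑ xs f ≈ 0#
    ∑-0 []       f≈0 = ≈-refl
    ∑-0 (x ∷ xs) f≈0 = ≈-trans (+-cong (f≈0 x) (∑-0 xs f≈0)) (+-identityˡ 0#)

    ∑-+ : ∀ (xs : List A) (f g : A → Carrier) → ∑ xs (λ x → f x + g x) ≈ ∑ xs f + ∑ xs g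
    ∑-+ []       f g = ≈-sym (+-identityˡ 0#)
    ∑-+ (x ∷ xs) f g = ≈-trans (+-congˡ (∑-+ xs f g)) (interchange _ _ _ _)

    ∑-*ˡ : ∀ (k : Carrier) (xs : List A) (f : A → Carrier) → ∑ xs (λ x → k * f x) ≈ k * ∑ xs f
    ∑-*ˡ k []       f = ≈-sym (zeroʳ k)
    ∑-*ˡ k (x ∷ xs) f = ≈-trans (+-congˡ (∑-*ˡ k xs f)) (≈-sym (distribˡ k _ _))

    ∑-filter : ∀ {p} {P : Pred A p} (P? : Decidable P) (xs : List A) (f : A → Carrier) →
               ∑ (filter P? xs) f ≈ ∑ xs (λ x → if does (P? x) then f x else 0#)
    ∑-filter P? []       f = ≈-refl
    ∑-filter P? (x ∷ xs) f with does (P? x)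
    ... | true  = +-congˡ (∑-filter P? xs f)
    ... | false = ≈-trans (∑-filter P? xs f) (≈-sym (+-identityˡ _))

  module _ {a b} {A : Set a} {B : Set b} where

    ∑-swap : ∀ (xs : List A) (ys : List B) (f : A → B → Carrier) →
             ∑ xs (λ x → ∑ ys (f x)) ≈ ∑ ys (λ y → ∑ xs (λ x → f x y))
    ∑-swap []       ys f = ≈-sym (∑-0 ys λ _ → ≈-refl)
    ∑-swap (x ∷ xs) ys f =
      ≈-trans (+-congˡ (∑-swap xs ys f)) (≈-sym (∑-+ ys (f x) (λ y → ∑ xs (λ x → f x y))))

    ∑-cartesianProduct : ∀ (xs : List A) (ys : List B) (f : A × B → Carrier) →
      ∑ (cartesianProduct xs ys) f ≈ ∑ xs (λ x → ∑ ys (λ y → f (x , y)))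
    ∑-cartesianProduct []       ys f = ≈-refl
    ∑-cartesianProduct (x ∷ xs) ys f = ≈-trans (∑-++ (map (x ,_) ys) (cartesianProduct xs ys) f)
      (+-cong (reflexive (∑-map (x ,_) ys f)) (∑-cartesianProduct xs ys f))

  ∑-subsets-suc : ∀ (f : Subset (suc n) → Carrier) →
    ∑ (subsets (suc n)) f ≈ ∑ (subsets n) (f ∘ (outside ∷_)) + ∑ (subsets n) (f ∘ (inside ∷_))
  ∑-subsets-suc {n} f = ≈-trans
    (∑-++ (map (outside ∷_) (subsets n)) (map (inside ∷_) (subsets n)) f)
    (reflexive (cong₂ _+_ (∑-map (outside ∷_) (subsets n) f) (∑-map (inside ∷_) (subsets n) f)))

  -- The half of `subsets` whose first entry disagrees with that of `X` contributes nothing, and the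
  -- other half is the same problem with one point fewer. In this way each set is counted exactly
  -- once.
  ∑-subsets-single : ∀ (X : Subset n) (f : Subset n → Carrier) →
    (∀ Y → Y ≢ X → f Y ≈ 0#) → ∑ (subsets n) f ≈ f X
  ∑-subsets-single [] f _ = +-identityʳ _
  ∑-subsets-single {suc n} (outside ∷ X) f vanish = begin
    ∑ (subsets (suc n)) f                                                     ≈⟨ ∑-subsets-suc f ⟩
    ∑ (subsets n) (f ∘ (outside ∷_)) + ∑ (subsets n) (f ∘ (inside ∷_))        ≈⟨ +-cong
      (∑-subsets-single X _ λ Y Y≢X → vanish _ λ { refl → Y≢X refl })
      (∑-0 (subsets n) λ Y → vanish _ λ ()) ⟩
    f (outside ∷ X) + 0#                                                      ≈⟨ +-identityʳ _ ⟩
    f (outside ∷ X)                                                           ∎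
  ∑-subsets-single {suc n} (inside ∷ X) f vanish = begin
    ∑ (subsets (suc n)) f                                                     ≈⟨ ∑-subsets-suc f ⟩
    ∑ (subsets n) (f ∘ (outside ∷_)) + ∑ (subsets n) (f ∘ (inside ∷_))        ≈⟨ +-cong
      (∑-0 (subsets n) λ Y → vanish _ λ ())
      (∑-subsets-single X _ λ Y Y≢X → vanish _ λ { refl → Y≢X refl }) ⟩
    0# + f (inside ∷ X)                                                       ≈⟨ +-identityˡ _ ⟩
    f (inside ∷ X)                                                            ∎

  ∑-filter-subsets-single : ∀ {p} {P : Pred (Subset n) p} (P? : Decidable P)
    (X : Subset n) (f : Subset n → Carrier) → P X →
    (∀ Y → P Y → Y ≢ X → f Y ≈ 0#) → ∑ (filter P? (subsets n)) f ≈ f X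
  ∑-filter-subsets-single {n} P? X f pX vanish = begin
    ∑ (filter P? (subsets n)) f                               ≈⟨ ∑-filter P? (subsets n) f ⟩
    ∑ (subsets n) (λ Y → if does (P? Y) then f Y else 0#)     ≈⟨ ∑-subsets-single X _
      (λ Y Y≢X → if-does-≈0 (P? Y) λ pY → vanish Y pY Y≢X) ⟩
    (if does (P? X) then f X else 0#)                         ≈⟨ if-does-true (P? X) pX ⟩
    f X                                                       ∎

  -- Together with `0^∣⊥∣≈1` this makes the power of `0#` an indicator of emptiness, both for the
  -- third part of a tripartition and for the containment encoded in `twistTerm`.
  0^∣X∣≈0 : (X : Subset n) → X ≢ ⊥ → 0# ^ ∣ X ∣ ≈ 0#
  0^∣X∣≈0 []            X≢⊥ = contradiction refl X≢⊥
  0^∣X∣≈0 (outside ∷ X) X≢⊥ = 0^∣X∣≈0 X (X≢⊥ ∘ cong (outside ∷_))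
  0^∣X∣≈0 (inside  ∷ X) X≢⊥ = zeroˡ _

  0^∣⊥∣≈1 : {X : Subset n} → X ≡ ⊥ → 0# ^ ∣ X ∣ ≈ 1#
  0^∣⊥∣≈1 {n} refl = ^-congʳ 0# (∣⊥∣≡0 n)

  -- Splits off the first point: `α` is its factor when `B` omits it, `β` when `B` contains it. The
  -- value `t` is left free so that `α + β` can be regrouped to fit the goal.
  ∑-subsets-product : ∀ (α β : Carrier) {s t : Carrier}
      (f : Subset (suc n) → Carrier) (g : Subset n → Carrier) →
    (∀ B → f (outside ∷ B) ≈ α * g B) → (∀ B → f (inside ∷ B) ≈ β * g B) →
    ∑ (subsets n) g ≈ s → (α + β) * s ≈ t → ∑ (subsets (suc n)) f ≈ t
  ∑-subsets-product {n} α β {s} {t} f g f-out f-in g≈s eq = begin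
    ∑ (subsets (suc n)) f                                               ≈⟨ ∑-subsets-suc f ⟩
    ∑ (subsets n) (f ∘ (outside ∷_)) + ∑ (subsets n) (f ∘ (inside ∷_))
      ≈⟨ +-cong (≈-trans (∑-cong (subsets n) f-out) (∑-*ˡ α (subsets n) g))
                (≈-trans (∑-cong (subsets n) f-in) (∑-*ˡ β (subsets n) g)) ⟩
    α * ∑ (subsets n) g + β * ∑ (subsets n) g                           ≈⟨ distribʳ _ α β ⟨
    (α + β) * ∑ (subsets n) g                                           ≈⟨ *-congˡ g≈s ⟩
    (α + β) * s                                                         ≈⟨ eq ⟩
    t                                                                   ∎

  -- Expansion of the summand of a fixed `F`.

  module _ (w w⁻¹ x x⁻¹ y : Carrier) where

    -- The power of 0# is the indicator of B Δ F ⊆ T; as a power it factors over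
    -- the points of E like the rest of the term.
    twistTerm : Subset n → Subset n → Subset n → Carrier
    twistTerm T F B = w ^ ∣ ∁ B ∣ * x ^ ∣ B ∣ * (y ^ ∣ B Δ F ∣ * 0# ^ ∣ (B Δ F) ∩ ∁ T ∣)

    activityTerm : Subset n → Subset n → Carrier
    activityTerm T F = w ^ ∣ ∁ F ∣ * x ^ ∣ F ∣
      * (1# + w * x⁻¹ * y) ^ ∣ F ∩ T ∣ * (1# + x * w⁻¹ * y) ^ ∣ ∁ F ∩ T ∣

    x-factor : x * x⁻¹ ≈ 1# → x * (1# + w * x⁻¹ * y) ≈ w * y + x
    x-factor x-inv = begin
      x * (1# + w * x⁻¹ * y)      ≈⟨ solve 4 (λ x x⁻¹ w y →
        x :* (con 1 :+ w :* x⁻¹ :* y) := x :* x⁻¹ :* (w :* y) :+ x) ≈-refl x x⁻¹ w y ⟩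
      x * x⁻¹ * (w * y) + x       ≈⟨ +-congʳ (*-congʳ x-inv) ⟩
      1# * (w * y) + x            ≈⟨ +-congʳ (*-identityˡ _) ⟩
      w * y + x                   ∎

    w-factor : w * w⁻¹ ≈ 1# → w * (1# + x * w⁻¹ * y) ≈ w + x * y
    w-factor w-inv = begin
      w * (1# + x * w⁻¹ * y)      ≈⟨ solve 4 (λ x w⁻¹ w y →
        w :* (con 1 :+ x :* w⁻¹ :* y) := w :+ w :* w⁻¹ :* (x :* y)) ≈-refl x w⁻¹ w y ⟩
      w + w * w⁻¹ * (x * y)       ≈⟨ +-congˡ (*-congʳ w-inv) ⟩
      w + 1# * (x * y)            ≈⟨ +-congˡ (*-identityˡ _) ⟩
      w + x * y                   ∎

    -- Both sides factor over the points. A point outside `T` contributes `w` or `x`, as it lies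
    -- outside or inside `F`, because the other choice carries a factor `0#`. A point of `T`
    -- contributes `w + x * y` outside `F` and `w * y + x` inside `F`; the inverses turn these into
    -- `w` or `x` times the activity factor. `T` is arbitrary because the induction shortens it
    -- along with `F`.
    ∑-twistTerm : w * w⁻¹ ≈ 1# → x * x⁻¹ ≈ 1# → ∀ (T F : Subset n) →
      ∑ (subsets n) (twistTerm T F) ≈ activityTerm T F
    ∑-twistTerm w-inv x-inv [] [] = solve 0
      (con 1 :* con 1 :* (con 1 :* con 1) :+ con 0 := con 1 :* con 1 :* con 1 :* con 1) ≈-refl
    ∑-twistTerm w-inv x-inv (outside ∷ T) (outside ∷ F) = ∑-subsets-product w (x * (y * 0#))
      (twistTerm (outside ∷ T) (outside ∷ F)) (twistTerm T F)
      (λ B → solve 5 (λ w a b c d → w :* a :* b :* (c :* d) := w :* (a :* b :* (c :* d))) ≈-refl w _ _ _ _)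
      (λ B → solve 7 (λ x y z a b c d → a :* (x :* b) :* (y :* c :* (z :* d))
                            := x :* (y :* z) :* (a :* b :* (c :* d))) ≈-refl x y 0# _ _ _ _)
      (∑-twistTerm w-inv x-inv T F)
      (solve 7 (λ w x y a b c d → (w :+ x :* (y :* con 0)) :* (a :* b :* c :* d) := w :* a :* b :* c :* d)
        ≈-refl w x y _ _ _ _)
    ∑-twistTerm w-inv x-inv (inside ∷ T) (outside ∷ F) = ∑-subsets-product w (x * y)
      (twistTerm (inside ∷ T) (outside ∷ F)) (twistTerm T F)
      (λ B → solve 5 (λ w a b c d → w :* a :* b :* (c :* d) := w :* (a :* b :* (c :* d))) ≈-refl w _ _ _ _)
      (λ B → solve 6 (λ x y a b c d → a :* (x :* b) :* (y :* c :* d) := x :* y :* (a :* b :* (c :* d)))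
        ≈-refl x y _ _ _ _)
      (∑-twistTerm w-inv x-inv T F)
      (≈-trans (*-congʳ (≈-sym (w-factor w-inv)))
        (solve 6 (λ w q a b c d → w :* q :* (a :* b :* c :* d) := w :* a :* b :* c :* (q :* d))
          ≈-refl w _ _ _ _ _))
    ∑-twistTerm w-inv x-inv (outside ∷ T) (inside ∷ F) = ∑-subsets-product (w * (y * 0#)) x
      (twistTerm (outside ∷ T) (inside ∷ F)) (twistTerm T F)
      (λ B → solve 7 (λ w y z a b c d → w :* a :* b :* (y :* c :* (z :* d))
                            := w :* (y :* z) :* (a :* b :* (c :* d))) ≈-refl w y 0# _ _ _ _)
      (λ B → solve 5 (λ x a b c d → a :* (x :* b) :* (c :* d) := x :* (a :* b :* (c :* d))) ≈-refl x _ _ _ _)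
      (∑-twistTerm w-inv x-inv T F)
      (solve 7 (λ w x y a b c d → (w :* (y :* con 0) :+ x) :* (a :* b :* c :* d) := a :* (x :* b) :* c :* d)
        ≈-refl w x y _ _ _ _)
    ∑-twistTerm w-inv x-inv (inside ∷ T) (inside ∷ F) = ∑-subsets-product (w * y) x
      (twistTerm (inside ∷ T) (inside ∷ F)) (twistTerm T F)
      (λ B → solve 6 (λ w y a b c d → w :* a :* b :* (y :* c :* d) := w :* y :* (a :* b :* (c :* d)))
        ≈-refl w y _ _ _ _)
      (λ B → solve 5 (λ x a b c d → a :* (x :* b) :* (c :* d) := x :* (a :* b :* (c :* d))) ≈-refl x _ _ _ _)
      (∑-twistTerm w-inv x-inv T F)
      (≈-trans (*-congʳ (≈-sym (x-factor x-inv)))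
        (solve 6 (λ x p a b c d → x :* p :* (a :* b :* c :* d) := a :* (x :* b) :* (p :* c) :* d)
          ≈-refl x _ _ _ _ _))

  -- The transition polynomial at `z = 0` as a sum over `B`.

  ∑-P₃ : ∀ (f : Subset n → Subset n → Subset n → Carrier) →
    (∀ A B C → C ≢ ⊥ → f A B C ≈ 0#) →
    ∑ (P₃ n) (λ (A , B , C) → f A B C) ≈ ∑ (subsets n) (λ B → f (∁ B) B ⊥)
  ∑-P₃ {n} f f≈0 = begin
    ∑ (P₃ n) (λ (A , B , C) → f A B C)
      ≈⟨ ∑-filter partition₃? (cartesianProduct S (cartesianProduct S S)) (λ (A , B , C) → f A B C) ⟩
    ∑ (cartesianProduct S (cartesianProduct S S)) (λ (A , B , C) → term A B C)
      ≈⟨ ∑-cartesianProduct S (cartesianProduct S S) (λ (A , B , C) → term A B C) ⟩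
    ∑ S (λ A → ∑ (cartesianProduct S S) (λ (B , C) → term A B C))
      ≈⟨ ∑-cong S (λ A → ∑-cartesianProduct S S (λ (B , C) → term A B C)) ⟩
    ∑ S (λ A → ∑ S (λ B → ∑ S (λ C → term A B C)))
      -- `B` becomes the outer index because it determines `A` and `C` in the surviving terms.
      ≈⟨ ∑-swap S S (λ A B → ∑ S (λ C → term A B C)) ⟩
    ∑ S (λ B → ∑ S (λ A → ∑ S (λ C → term A B C)))
      ≈⟨ ∑-cong S (λ B → ∑-subsets-single (∁ B) (λ A → ∑ S (λ C → term A B C)) λ A A≢∁B →
           ∑-0 S (λ C → vanish A B C (A≢∁B ∘ proj₁))) ⟩
    ∑ S (λ B → ∑ S (λ C → term (∁ B) B C))
      ≈⟨ ∑-cong S (λ B → ∑-subsets-single ⊥ (λ C → term (∁ B) B C) λ C C≢⊥ →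
           vanish (∁ B) B C (C≢⊥ ∘ proj₂)) ⟩
    ∑ S (λ B → term (∁ B) B ⊥)
      ≈⟨ ∑-cong S (λ B → if-does-true (partition₃? (∁ B , B , ⊥)) (partition₃-∁ B)) ⟩
    ∑ S (λ B → f (∁ B) B ⊥) ∎
    where
    S = subsets n

    term : Subset n → Subset n → Subset n → Carrier
    term A B C = if does (partition₃? (A , B , C)) then f A B C else 0#

    vanish : ∀ A B C → ¬ (A ≡ ∁ B × C ≡ ⊥) → term A B C ≈ 0#
    vanish A B C ≢ = if-does-≈0 (partition₃? (A , B , C)) λ p →
      -- If `C` were empty, the partition would force `A ≡ ∁ B`, which is the excluded triple.
      f≈0 A B C λ { refl → ≢ (partition₃-⊥⇒≡∁ p , refl) }

  Q-z≡0 : ∀ (w x y : Carrier) (D : DeltaMatroid n) →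
    Q w x 0# D y ≈ ∑ (subsets n) (λ B → w ^ ∣ ∁ B ∣ * x ^ ∣ B ∣ * y ^ rMin (D *ᵗ B))
  Q-z≡0 {n} w x y D = ≈-trans
    (∑-P₃ (λ A B C → w ^ ∣ A ∣ * x ^ ∣ B ∣ * 0# ^ ∣ C ∣ * y ^ rMin (D *ᵗ B))
      λ A B C C≢⊥ → annihilate (0^∣X∣≈0 C C≢⊥))
    (∑-cong (subsets n) λ B → *-congʳ (≈-trans (*-congˡ (0^∣⊥∣≈1 {X = ⊥ {n}} refl)) (*-identityʳ _)))
    where
    annihilate : ∀ {a b c} → b ≈ 0# → a * b * c ≈ 0#
    annihilate b≈0 = ≈-trans (*-congʳ (≈-trans (*-congˡ b≈0) (zeroʳ _))) (zeroˡ _)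

  -- The double sum over the pairs of a feasible `F` and a subset `B`.

  module _ (w w⁻¹ x x⁻¹ y : Carrier) (D : DeltaMatroid n)
           {r} {_<_ : Rel (Fin n) r} (sto : IsStrictTotalOrder _≡_ _<_) where

    -- Exactly one feasible set passes the indicator: `activeOrientable-exists` supplies it along
    -- with the exponent of `y`, and `activeOrientable-unique` annihilates all other terms.
    ∑-feasible-twistTerm : ∀ B →
      ∑ (feasibleSets D) (λ F → twistTerm w w⁻¹ x x⁻¹ y (AO D sto F) F B)
        ≈ w ^ ∣ ∁ B ∣ * x ^ ∣ B ∣ * y ^ rMin (D *ᵗ B)
    ∑-feasible-twistTerm B = let F₀ , h₀ , F₀-good , r≡ = activeOrientable-exists D sto B in ≈-trans
      (∑-filter-subsets-single (feasible? D) F₀ (λ F → twistTerm w w⁻¹ x x⁻¹ y (AO D sto F) F B) h₀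
        λ F h F≢F₀ → annihilate (0^∣X∣≈0 ((B Δ F) ∩ ∁ (AO D sto F)) λ eq →
          F≢F₀ (activeOrientable-unique D sto h h₀ (∩∁≡⊥⇒⊆ eq) F₀-good)))
      (*-congˡ (≈-trans (*-cong (^-congʳ y (sym r≡)) (0^∣⊥∣≈1 (⊆⇒∩∁≡⊥ F₀-good))) (*-identityʳ _)))
      where
      annihilate : ∀ {a b c} → c ≈ 0# → a * (b * c) ≈ 0#
      annihilate c≈0 = ≈-trans (*-congˡ (≈-trans (*-congˡ c≈0) (zeroʳ _))) (zeroʳ _)

    activityTerm≈ : ∀ F → activityTerm w w⁻¹ x x⁻¹ y (AO D sto F) F ≈
      w ^ (n ∸ ∣ F ∣) * x ^ ∣ F ∣
        * (1# + w * x⁻¹ * y) ^ internalActivity D F sto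
        * (1# + x * w⁻¹ * y) ^ externalActivity D F sto
    activityTerm≈ F = *-cong (*-cong
      (*-congʳ (^-congʳ w (∣∁p∣≡n∸∣p∣ F)))
      (^-congʳ (1# + w * x⁻¹ * y) (sym (internalActivity≡ D sto F))))
      (^-congʳ (1# + x * w⁻¹ * y) (sym (externalActivity≡ D sto F)))

theorem4p15 : ∀ {c ℓ r} (R : CommutativeRing c ℓ) →
    let open CommutativeRing R
        open OverRing R
        open DeltaMatroid
    in
    (w w⁻¹ x x⁻¹ y : Carrier) → w * w⁻¹ ≈ 1# → x * x⁻¹ ≈ 1# →
    (n : ℕ) (D : DeltaMatroid n)
    {_<_ : Rel (Fin n) r} (sto : IsStrictTotalOrder _≡_ _<_) →
    Q w x 0# D y ≈
      ∑ (feasibleSets D) λ F →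
        w ^ (n ∸ ∣ F ∣) * x ^ ∣ F ∣
          * (1# + w * x⁻¹ * y) ^ internalActivity D F sto
          * (1# + x * w⁻¹ * y) ^ externalActivity D F sto
theorem4p15 R w w⁻¹ x x⁻¹ y w-inv x-inv n D sto = begin
  Q w x 0# D y
    ≈⟨ Q-z≡0 R w x y D ⟩
  ∑ S (λ B → w ^ ∣ ∁ B ∣ * x ^ ∣ B ∣ * y ^ rMin (D *ᵗ B))
    -- Each summand is spread over all feasible `F`; after the interchange, the inner sum over `B`
    -- factors for fixed `F`.
    ≈⟨ ∑-cong R S (∑-feasible-twistTerm R w w⁻¹ x x⁻¹ y D sto) ⟨
  ∑ S (λ B → ∑ (feasibleSets D) (λ F → t F B))
    ≈⟨ ∑-swap R (feasibleSets D) S t ⟨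
  ∑ (feasibleSets D) (λ F → ∑ S (t F))
    ≈⟨ ∑-cong R (feasibleSets D) (λ F → ≈-trans
         (∑-twistTerm R w w⁻¹ x x⁻¹ y w-inv x-inv (AO D sto F) F)
         (activityTerm≈ R w w⁻¹ x x⁻¹ y D sto F)) ⟩
  ∑ (feasibleSets D) (λ F → w ^ (n ∸ ∣ F ∣) * x ^ ∣ F ∣
    * (1# + w * x⁻¹ * y) ^ internalActivity D F sto
    * (1# + x * w⁻¹ * y) ^ externalActivity D F sto) ∎
  where
  open CommutativeRing R using (Carrier; _+_; _*_; 1#; 0#; setoid) renaming (trans to ≈-trans)
  open OverRing R
  open import Relation.Binary.Reasoning.Setoid setoid

  S = subsets n

  t : Subset n → Subset n → Carrier
  t F = twistTerm R w w⁻¹ x x⁻¹ y (AO D sto F) F
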